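{- Any $\varepsilon$-edge-differentially private algorithm to compute the weight of a minimum cut in an incremental graph sequence of length $T$ must have additive error $\Omega(W\log T)$ when the edge weights are in $\{1,\dots,W\}$ and $W$ is a publicly known parameter. This holds even with $\varepsilon=1$.
   Context: Graphs are undirected and edge-weighted. An incremental graph sequence $(G_1,\dots,G_T)$ arises from an initial (possibly non-empty) graph $G_0$ by inserting at each time $t$ a set $\partial V_t^+$ of nodes and a set $\partial E_t^+$ of edges (no deletions). Two incremental sequences are edge-adjacent (event-level) if they have the same length, initial graph and node insertions, and (up to exchanging them) there are an edge $e^*$ and a time $t^*$ with $\partial E_t^+=\partial E_t'^+$ for $t\ne t^*$, $\partial E_{t^*}'^+\subseteq\partial E_{t^*}^+$ and $\partial E_{t^*}^+\setminus\partial E_{t^*}'^+=\{e^*\}$. The algorithm is randomized and outputs a real number after each time step, an estimate of the value for the current graph. It is $\varepsilon$-edge-differentially private if $\Pr[\mathcal A(\mathcal G)\in S]\le e^\varepsilon\Pr[\mathcal A(\mathcal G')\in S]$ for all edge-adjacent $\mathcal G,\mathcal G'$ and all sets $S$ of possible output sequences. The additive error at a time step is the absolute difference between the output and the true value. The weight of a (global) minimum cut is the minimum total weight of edges crossing a partition of the nodes into two non-empty parts. -}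

module Defs where

open import Level using (0ℓ)
open import Algebra.Bundles using (CommutativeRing)
open import Algebra.Apartness.Bundles using (HeytingCommutativeRing; HeytingField)
import Algebra.Apartness.Properties.HeytingCommutativeRing as HeytingProperties
import Algebra.Definitions.RawMonoid as RawMonoidDefinitions
import Algebra.Properties.Ring as RingProperties
open import Data.Empty using (⊥-elim)
open import Data.Fin.Base using (Fin) renaming (_≤_ to _≤ᶠ_; _<_ to _<ᶠ_)
open import Data.Fin.Properties using () renaming (_≤?_ to _≤ᶠ?_)
open import Data.Fin.Subset
  using (Subset; _∈_; _∉_; _⊆_; _∪_; _─_; ⋃; Nonempty)
open import Data.Fin.Subset.Properties using (_∈?_)
open import Data.List.Base using (List; allFin; filter; map)
open import Data.Nat.Base as ℕ using (ℕ; zero; suc; _≤′_; ≤′-refl; ≤′-step)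
import Data.Nat.ListAction as List
import Data.Nat.Properties as ℕ
open import Data.Product.Base using (∃; _×_; _,_; proj₁; proj₂)
open import Data.Sum.Base using (_⊎_; inj₁; inj₂; [_,_]′)
open import Data.Unit.Base using (⊤)
import Data.Vec.Functional as Vector
open import Function.Base using (_∘_)
open import Function.Bundles using (_⇔_)
open import Relation.Binary.Definitions using (Transitive)
open import Relation.Binary.Structures using (IsStrictPartialOrder)
open import Relation.Binary.PropositionalEquality.Core using (_≡_; _≢_)
open import Relation.Nullary.Negation.Core using (¬_)

-- The real numbers, axiomatised as a Cauchy-complete Archimedean ordered
-- field.  The axioms are phrased constructively (non-strict order is the
-- negation of strict order); classically they characterise ℝ up to
-- isomorphism.

record RealNumbers : Set₁ where
  infix 4 _<_ _≤_

  field
    heytingField : HeytingField 0ℓ 0ℓ 0ℓ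

  open HeytingField heytingField public
    renaming (Carrier to ℝ; sym to ≈-sym; trans to ≈-trans; refl to ≈-refl)

  commutativeRing : CommutativeRing 0ℓ 0ℓ
  commutativeRing = HeytingCommutativeRing.commutativeRing heytingCommutativeRing

  open CommutativeRing commutativeRing public
    using (+-rawMonoid; ring)
  open RawMonoidDefinitions +-rawMonoid public
    using () renaming (_×_ to _·_)

  field
    _<_                  : ℝ → ℝ → Set
    isStrictPartialOrder : IsStrictPartialOrder _≈_ _<_
    #⇒<∨>                : ∀ {x y} → x # y → x < y ⊎ y < x
    <⇒#                  : ∀ {x y} → x < y → x # y
    +-monoʳ-<            : ∀ x {y z} → y < z → x + y < x + z
    *-pos                : ∀ {x y} → 0# < x → 0# < y → 0# < x * y

  _≤_ : ℝ → ℝ → Set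
  x ≤ y = ¬ (y < x)

  fromℕ : ℕ → ℝ
  fromℕ n = n · 1#

  -- ∣ x - y ∣ ≤ d
  Within : ℝ → ℝ → ℝ → Set
  Within d x y = x ≤ y + d × y ≤ x + d

  IsCauchy : (ℕ → ℝ) → Set
  IsCauchy f =
    ∀ δ → 0# < δ → ∃ λ N → ∀ m n → N ℕ.≤ m → N ℕ.≤ n → Within δ (f m) (f n)

  ConvergesTo : (ℕ → ℝ) → ℝ → Set
  ConvergesTo f l =
    ∀ δ → 0# < δ → ∃ λ N → ∀ n → N ℕ.≤ n → Within δ (f n) l

  field
    archimedean : ∀ x → ∃ λ n → x < fromℕ n
    complete    : ∀ f → IsCauchy f → ∃ λ l → ConvergesTo f l

  partialSum : (ℕ → ℝ) → ℕ → ℝ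
  partialSum f zero    = 0#
  partialSum f (suc n) = partialSum f n + f n

module OrderProperties (R : RealNumbers) where
  open RealNumbers R
  open IsStrictPartialOrder isStrictPartialOrder public
    using () renaming
      ( irrefl to <-irrefl; trans to <-trans
      ; <-respʳ-≈ to <-respʳ; <-respˡ-≈ to <-respˡ )
  open HeytingProperties heytingCommutativeRing using (1#0; x-0≈x)
  open RingProperties ring
    using (-‿distribˡ-*; -‿involutive)
  open import Relation.Binary.Reasoning.Setoid setoid

  <-cotrans : ∀ {x y} → x < y → ∀ z → x < z ⊎ z < y
  <-cotrans x<y z with #-cotrans (<⇒# x<y) z
  ... | inj₁ x#z = [ inj₁ , (λ z<x → inj₂ (<-trans z<x x<y)) ]′ (#⇒<∨> x#z)
  ... | inj₂ z#y = [ inj₂ , (λ y<z → inj₁ (<-trans x<y y<z)) ]′ (#⇒<∨> z#y)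

  <⇒≤ : ∀ {x y} → x < y → x ≤ y
  <⇒≤ x<y y<x = <-irrefl ≈-refl (<-trans x<y y<x)

  ≤-reflexive : ∀ {x y} → x ≈ y → x ≤ y
  ≤-reflexive x≈y y<x = <-irrefl (≈-sym x≈y) y<x

  ≤-refl : ∀ {x} → x ≤ x
  ≤-refl = ≤-reflexive ≈-refl

  ≤-trans : Transitive _≤_
  ≤-trans {_} {y} x≤y y≤z z<x = [ y≤z , x≤y ]′ (<-cotrans z<x y)

  <-≤-trans : ∀ {x y z} → x < y → y ≤ z → x < z
  <-≤-trans {z = z} x<y y≤z with <-cotrans x<y z
  ... | inj₁ x<z = x<z
  ... | inj₂ z<y = ⊥-elim (y≤z z<y)

  +-monoˡ-< : ∀ x {y z} → y < z → y + x < z + x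
  +-monoˡ-< x y<z =
    <-respˡ (+-comm x _) (<-respʳ (+-comm x _) (+-monoʳ-< x y<z))

  -‿cancelˡ : ∀ x y → - x + (x + y) ≈ y
  -‿cancelˡ x y = begin
    - x + (x + y) ≈⟨ +-assoc (- x) x y ⟨
    - x + x + y   ≈⟨ +-congʳ (-‿inverseˡ x) ⟩
    0# + y        ≈⟨ +-identityˡ y ⟩
    y             ∎

  +-monoʳ-≤ : ∀ x {y z} → y ≤ z → x + y ≤ x + z
  +-monoʳ-≤ x y≤z x+z<x+y = y≤z
    (<-respˡ (-‿cancelˡ x _) (<-respʳ (-‿cancelˡ x _) (+-monoʳ-< (- x) x+z<x+y)))

  +-monoˡ-≤ : ∀ x {y z} → y ≤ z → y + x ≤ z + x
  +-monoˡ-≤ x y≤z = ≤-trans (≤-reflexive (+-comm _ x))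
    (≤-trans (+-monoʳ-≤ x y≤z) (≤-reflexive (+-comm x _)))

  x<x+y : ∀ x {y} → 0# < y → x < x + y
  x<x+y x 0<y = <-respˡ (+-identityʳ x) (+-monoʳ-< x 0<y)

  x<0⇒0<-x : ∀ {x} → x < 0# → 0# < - x
  x<0⇒0<-x {x} x<0 =
    <-respˡ (-‿inverseˡ x) (<-respʳ (+-identityʳ (- x)) (+-monoʳ-< (- x) x<0))

  0<1 : 0# < 1#
  0<1 with #⇒<∨> 1#0
  ... | inj₂ 0<1 = 0<1
  ... | inj₁ 1<0 = <-respʳ [-1]²≈1 (*-pos 0<-1 0<-1)
    where
    0<-1 = x<0⇒0<-x 1<0
    [-1]²≈1 : - 1# * - 1# ≈ 1#
    [-1]²≈1 = begin
      - 1# * - 1#   ≈⟨ -‿distribˡ-* 1# (- 1#) ⟨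
      - (1# * - 1#) ≈⟨ -‿cong (*-identityˡ (- 1#)) ⟩
      - - 1#        ≈⟨ -‿involutive 1# ⟩
      1#            ∎

  *-monoʳ-< : ∀ {x y z} → 0# < x → y < z → x * y < x * z
  *-monoʳ-< {x} {y} {z} 0<x y<z =
    <-respʳ eq (x<x+y (x * y) (*-pos 0<x 0<z-y))
    where
    0<z-y : 0# < - y + z
    0<z-y = <-respˡ (-‿inverseˡ y) (+-monoʳ-< (- y) y<z)
    eq : x * y + x * (- y + z) ≈ x * z
    eq = begin
      x * y + x * (- y + z) ≈⟨ distribˡ x y (- y + z) ⟨
      x * (y + (- y + z))   ≈⟨ *-congˡ (+-assoc y (- y) z) ⟨
      x * (y + - y + z)     ≈⟨ *-congˡ (+-congʳ (-‿inverseʳ y)) ⟩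
      x * (0# + z)          ≈⟨ *-congˡ (+-identityˡ z) ⟩
      x * z                 ∎

  *-monoˡ-< : ∀ {x y z} → 0# < x → y < z → y * x < z * x
  *-monoˡ-< {x} 0<x y<z =
    <-respˡ (*-comm x _) (<-respʳ (*-comm x _) (*-monoʳ-< 0<x y<z))

  inverse : ∀ {x} → 0# < x → ∃ λ x⁻¹ → x * x⁻¹ ≈ 1#
  inverse {x} 0<x with #⇒invertible (#-sym (<⇒# 0<x))
  ... | x⁻¹ , _ , eq = x⁻¹ , ≈-trans (*-congʳ (≈-sym (x-0≈x x))) eq

  inverse-pos : ∀ {x y} → 0# < x → x * y ≈ 1# → 0# < y
  inverse-pos {x} {y} 0<x xy≈1 with <-cotrans 0<1 (y * y)
  ... | inj₁ 0<y² = <-respʳ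
          (begin
            x * (y * y) ≈⟨ *-assoc x y y ⟨
            x * y * y   ≈⟨ *-congʳ xy≈1 ⟩
            1# * y      ≈⟨ *-identityˡ y ⟩
            y           ∎)
          (*-pos 0<x 0<y²)
  ... | inj₂ _ with <-cotrans 0<1 y
  ...   | inj₁ 0<y = 0<y
  ...   | inj₂ _   with #⇒<∨> y#0
    where
    y#0 : y # 0#
    y#0 = HeytingProperties.invertibleʳ⇒# heytingCommutativeRing
            (x , ≈-trans (*-congʳ (x-0≈x y)) (≈-trans (*-comm y x) xy≈1))
  ...     | inj₂ 0<y = 0<y
  ...     | inj₁ y<0 = ⊥-elim (<-irrefl ≈-refl (<-trans 0<1 1<0))
    where
    1<0 : 1# < 0#
    1<0 = <-respˡ xy≈1 (<-respʳ (zeroʳ x) (*-monoʳ-< 0<x y<0))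

  fromℕ-mono-< : ∀ {m n} → m ℕ.< n → fromℕ m < fromℕ n
  fromℕ-mono-< = go ∘ ℕ.≤⇒≤′
    where
    n<1+n : ∀ n → fromℕ n < fromℕ (suc n)
    n<1+n n = <-respʳ (+-comm _ _) (x<x+y (fromℕ n) 0<1)
    go : ∀ {m n} → suc m ≤′ n → fromℕ m < fromℕ n
    go {m} ≤′-refl     = n<1+n m
    go {n = suc n} (≤′-step p) = <-trans (go p) (n<1+n n)

  0<1+n : ∀ n → 0# < fromℕ (suc n)
  0<1+n n = fromℕ-mono-< {0} {suc n} (ℕ.s≤s ℕ.z≤n)

module Exponential (R : RealNumbers) where
  open RealNumbers R
  open OrderProperties R
  open import Relation.Binary.Reasoning.Setoid setoid

  1/[1+_] : ℕ → ℝ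
  1/[1+ n ] = proj₁ (inverse (0<1+n n))

  -- x ^ n / n !
  expTerm : ℝ → ℕ → ℝ
  expTerm x zero    = 1#
  expTerm x (suc n) = expTerm x n * (x * 1/[1+ n ])

  module _ (x : ℝ) (0<x : 0# < x) where
    private
      a S : ℕ → ℝ
      a = expTerm x
      S = partialSum a

      0</ : ∀ n → 0# < 1/[1+ n ]
      0</ n = inverse-pos (0<1+n n) (proj₂ (inverse (0<1+n n)))

      0<a : ∀ n → 0# < a n
      0<a zero    = 0<1
      0<a (suc n) = *-pos (0<a n) (*-pos 0<x (0</ n))

      N : ℕ
      N = proj₁ (archimedean (x + x))

      halving : ∀ n → N ℕ.≤ n → a (suc n) + a (suc n) < a n
      halving n N≤n = <-respˡ
        (≈-trans (*-congˡ (distribʳ _ x x)) (distribˡ _ _ _))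
        (<-respʳ (*-identityʳ (a n)) (*-monoʳ-< (0<a n)
          (<-respʳ (proj₂ (inverse (0<1+n n))) (*-monoˡ-< (0</ n)
            (<-trans (proj₂ (archimedean (x + x))) (fromℕ-mono-< (ℕ.s≤s N≤n)))))))

      S-mono : ∀ {m n} → m ≤′ n → S m ≤ S n
      S-mono ≤′-refl              = ≤-refl
      S-mono {n = suc n} (≤′-step p) =
        ≤-trans (S-mono p) (<⇒≤ (x<x+y (S n) (0<a n)))

      -- S n sums the first n terms, so S n + 2 (a n) bounds the series.
      U : ℕ → ℝ
      U n = S n + (a n + a n)

      U-step : ∀ n → N ℕ.≤ n → U (suc n) ≤ U n
      U-step n N≤n = <⇒≤ (<-respʳ (+-assoc (S n) (a n) (a n))
        (+-monoʳ-< (S n + a n) (halving n N≤n)))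

      U-anti : ∀ {m n} → N ℕ.≤ m → m ≤′ n → U n ≤ U m
      U-anti N≤m ≤′-refl              = ≤-refl
      U-anti {m} {suc n} N≤m (≤′-step p) =
        ≤-trans (U-step n (ℕ.≤-trans N≤m (ℕ.≤′⇒≤ p))) (U-anti N≤m p)

      S≤U : ∀ {m n} → N ℕ.≤ m → m ≤′ n → S n ≤ U m
      S≤U {m} {n} N≤m p = ≤-trans
        (<⇒≤ (x<x+y (S n) (<-trans (0<a n) (x<x+y (a n) (0<a n)))))
        (U-anti N≤m p)

      y≤[1+j]y : ∀ j {y} → 0# < y → y ≤ fromℕ (suc j) * y
      y≤[1+j]y zero    {y} 0<y = ≤-reflexive
        (≈-sym (≈-trans (*-congʳ (+-identityʳ 1#)) (*-identityˡ y)))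
      y≤[1+j]y (suc j) {y} 0<y = <⇒≤
        (<-respˡ (*-identityˡ y) (*-monoˡ-< 0<y (x<x+y 1# (0<1+n j))))

      decay : ∀ j → fromℕ (suc j) * a (j ℕ.+ N) ≤ a N
      decay zero    = ≤-reflexive
        (≈-trans (*-congʳ (+-identityʳ 1#)) (*-identityˡ (a N)))
      decay (suc j) = ≤-trans (≤-trans step₁ step₂) (decay j)
        where
        b c : ℝ
        b = a (suc j ℕ.+ N)
        c = fromℕ (suc j)
        b≤cb : b ≤ c * b
        b≤cb = y≤[1+j]y j (0<a (suc j ℕ.+ N))
        step₁ : fromℕ (suc (suc j)) * b ≤ c * (b + b)
        step₁ = ≤-trans
          (≤-reflexive (≈-trans (distribʳ b 1# c) (+-congʳ (*-identityˡ b))))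
          (≤-trans (+-monoˡ-≤ (c * b) b≤cb)
            (≤-reflexive (≈-sym (distribˡ c b b))))
        step₂ : c * (b + b) ≤ c * a (j ℕ.+ N)
        step₂ = <⇒≤ (*-monoʳ-< (0<1+n j) (halving (j ℕ.+ N) (ℕ.m≤n+m N j)))

      vanish : ∀ δ → 0# < δ → ∃ λ j → a (j ℕ.+ N) ≤ δ
      vanish δ 0<δ with inverse 0<δ
      ... | δ⁻¹ , δδ⁻¹≈1 with archimedean (a N * δ⁻¹)
      ... | j , aδ⁻¹<j = j , λ δ<a → decay j
              (<-trans
                (<-respˡ
                  (begin
                    a N * δ⁻¹ * δ   ≈⟨ *-assoc (a N) δ⁻¹ δ ⟩
                    a N * (δ⁻¹ * δ) ≈⟨ *-congˡ (≈-trans (*-comm δ⁻¹ δ) δδ⁻¹≈1) ⟩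
                    a N * 1#        ≈⟨ *-identityʳ (a N) ⟩
                    a N             ∎)
                  (*-monoˡ-< 0<δ (<-trans aδ⁻¹<j (fromℕ-mono-< (ℕ.n<1+n j)))))
                (*-monoʳ-< (0<1+n j) δ<a))

    expSeries-isCauchy : IsCauchy (partialSum (expTerm x))
    expSeries-isCauchy δ 0<δ with vanish δ 0<δ
    ... | j , a≤δ = suc K , λ m n K<m K<n → close m n K<m K<n , close n m K<n K<m
      where
      K : ℕ
      K = j ℕ.+ N
      U-K : ∀ {m} → suc K ℕ.≤ m → S m ≤ S (suc K) + δ
      U-K K<m = ≤-trans (S≤U (ℕ.m≤n⇒m≤1+n (ℕ.m≤n+m N j)) (ℕ.≤⇒≤′ K<m))
        (+-monoʳ-≤ (S (suc K)) (≤-trans (<⇒≤ (halving K (ℕ.m≤n+m N j))) a≤δ))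
      close : ∀ m n → suc K ℕ.≤ m → suc K ℕ.≤ n → S m ≤ S n + δ
      close m n K<m K<n =
        ≤-trans (U-K K<m) (+-monoˡ-≤ δ (S-mono (ℕ.≤⇒≤′ K<n)))

    exp : ℝ
    exp = proj₁ (complete _ expSeries-isCauchy)

-- An undirected simple graph on (part of) the node universe Fin n, with edge
-- weights in {1, …, W}: weight u v ≡ 0 means that there is no edge uv.

record EdgeSet (n W : ℕ) : Set where
  field
    weight    : Fin n → Fin n → ℕ
    weight≤W  : ∀ u v → weight u v ℕ.≤ W
    symmetric : ∀ u v → weight u v ≡ weight v u
    loopless  : ∀ u → weight u u ≡ 0

open EdgeSet public using (weight)

infix 4 _─_∈ᴱ_ _─_∉ᴱ_

_─_∈ᴱ_ _─_∉ᴱ_ : ∀ {n W} → Fin n → Fin n → EdgeSet n W → Set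
u ─ v ∈ᴱ E = weight E u v ≢ 0
u ─ v ∉ᴱ E = weight E u v ≡ 0

infix 4 _≗ᴱ_

_≗ᴱ_ : ∀ {n W} → EdgeSet n W → EdgeSet n W → Set
E ≗ᴱ F = ∀ u v → weight E u v ≡ weight F u v

-- Inclusion as sets of weighted edges.
_⊆ᴱ_ : ∀ {n W} → EdgeSet n W → EdgeSet n W → Set
E ⊆ᴱ F = ∀ u v → u ─ v ∈ᴱ E → weight E u v ≡ weight F u v

SameEdge : ∀ {n} → Fin n → Fin n → Fin n → Fin n → Set
SameEdge u v u′ v′ = (u ≡ u′ × v ≡ v′) ⊎ (u ≡ v′ × v ≡ u′)

upTo : ∀ {T} → Fin T → List (Fin T)
upTo {T} t = filter (_≤ᶠ? t) (allFin T)

-- V₀ and E₀ form the initial graph; ∂V t and ∂E t are inserted at time t.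

record IncrementalSequence (n W T : ℕ) : Set where
  field
    V₀ : Subset n
    E₀ : EdgeSet n W
    ∂V : Fin T → Subset n
    ∂E : Fin T → EdgeSet n W

  -- The graph after the insertions of time t.  Each edge is inserted at most
  -- once (∂E-fresh), so at most one summand of weightAt is nonzero.

  nodesAt : Fin T → Subset n
  nodesAt t = V₀ ∪ ⋃ (map ∂V (upTo t))

  weightAt : Fin T → Fin n → Fin n → ℕ
  weightAt t u v =
    weight E₀ u v ℕ.+ List.sum (map (λ s → weight (∂E s) u v) (upTo t))

  field
    E₀-endpoints : ∀ u v → u ─ v ∈ᴱ E₀ → u ∈ V₀
    ∂E-endpoints : ∀ t u v → u ─ v ∈ᴱ ∂E t → u ∈ nodesAt t
    ∂V-fresh     : ∀ t u → u ∈ ∂V t →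
                   u ∉ V₀ × (∀ s → s <ᶠ t → u ∉ ∂V s)
    ∂E-fresh     : ∀ t u v → u ─ v ∈ᴱ ∂E t →
                   u ─ v ∉ᴱ E₀ × (∀ s → s <ᶠ t → u ─ v ∉ᴱ ∂E s)

open IncrementalSequence public

-- G′ is obtained from G by omitting one edge insertion.

record OmitsEdge {n W T : ℕ} (G G′ : IncrementalSequence n W T) : Set where
  field
    same-V₀   : V₀ G ≡ V₀ G′
    same-E₀   : E₀ G ≗ᴱ E₀ G′
    same-∂V   : ∀ t → ∂V G t ≡ ∂V G′ t
    t*        : Fin T
    u* v*     : Fin n
    same-∂E   : ∀ t → t ≢ t* → ∂E G t ≗ᴱ ∂E G′ t
    included  : ∂E G′ t* ⊆ᴱ ∂E G t*
    only-u*v* : ∀ u v →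
      (u ─ v ∈ᴱ ∂E G t* × u ─ v ∉ᴱ ∂E G′ t*) ⇔ SameEdge u v u* v*

EdgeAdjacent : ∀ {n W T} → IncrementalSequence n W T → IncrementalSequence n W T → Set
EdgeAdjacent G G′ = OmitsEdge G G′ ⊎ OmitsEdge G′ G

-- The cut with parts S and V ─ S.

IsCut : ∀ {n} → Subset n → Subset n → Set
IsCut V S = S ⊆ V × Nonempty S × Nonempty (V ─ S)

elements : ∀ {n} → Subset n → List (Fin n)
elements {n} S = filter (_∈? S) (allFin n)

cutWeight : ∀ {n} → Subset n → (Fin n → Fin n → ℕ) → Subset n → ℕ
cutWeight V w S =
  List.sum (map (λ u → List.sum (map (w u) (elements (V ─ S)))) (elements S))

IsMinCutWeight : ∀ {n} → Subset n → (Fin n → Fin n → ℕ) → ℕ → Set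
IsMinCutWeight V w m =
  (∃ λ S → IsCut V S × cutWeight V w S ≡ m) ×
  (∀ S → IsCut V S → m ℕ.≤ cutWeight V w S)

module ContinualRelease (R : RealNumbers) where
  open RealNumbers R
  open Exponential R

  -- Codes for the Borel subsets of ℝ ^ T.  Intersections and both kinds of
  -- half-space are included because they are not constructively definable
  -- from the rest.

  data Borel (T : ℕ) : Set where
    whole          : Borel T
    atMost atLeast : Fin T → ℝ → Borel T
    ∁              : Borel T → Borel T
    _∩_            : Borel T → Borel T → Borel T
    ⋃ℕ ⋂ℕ          : (ℕ → Borel T) → Borel T

  infix 4 _∈ᴮ_

  _∈ᴮ_ : ∀ {T} → (Fin T → ℝ) → Borel T → Set
  x ∈ᴮ whole       = ⊤
  x ∈ᴮ atMost t r  = x t ≤ r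
  x ∈ᴮ atLeast t r = r ≤ x t
  x ∈ᴮ ∁ A         = ¬ (x ∈ᴮ A)
  x ∈ᴮ A ∩ B       = x ∈ᴮ A × x ∈ᴮ B
  x ∈ᴮ ⋃ℕ A        = ∃ λ i → x ∈ᴮ A i
  x ∈ᴮ ⋂ℕ A        = ∀ i → x ∈ᴮ A i

  -- Pr-mono replaces the usual axiom of nonnegativity, which follows from it
  -- and Pr-empty; the converse, with Pr-additive, needs excluded middle.

  record ProbabilityMeasure (T : ℕ) : Set where
    field
      Pr          : Borel T → ℝ
      Pr-whole    : Pr whole ≈ 1#
      Pr-empty    : Pr (∁ whole) ≈ 0#
      Pr-mono     : ∀ A B → (∀ x → x ∈ᴮ A → x ∈ᴮ B) → Pr A ≤ Pr B
      Pr-additive : ∀ A → (∀ i j → i ≢ j → ∀ x → x ∈ᴮ A i → ¬ (x ∈ᴮ A j)) →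
                    ConvergesTo (partialSum (λ i → Pr (A i))) (Pr (⋃ℕ A))

  open ProbabilityMeasure public using (Pr)

  -- A randomised algorithm, as the distribution of its T outputs on each
  -- input.  The weight bound W is public: the algorithm may depend on it.

  Algorithm : ℕ → ℕ → Set
  Algorithm W T = ∀ {n} → IncrementalSequence n W T → ProbabilityMeasure T

  EdgeDifferentiallyPrivate : ∀ {W T} (ε : ℝ) → 0# < ε → Algorithm W T → Set
  EdgeDifferentiallyPrivate ε 0<ε 𝓐 =
    ∀ {n} (G G′ : IncrementalSequence n _ _) → EdgeAdjacent G G′ →
    ∀ S → Pr (𝓐 G) S ≤ exp ε 0<ε * Pr (𝓐 G′) S

  -- { x ∣ ∣ x t - v t ∣ ≤ α for all t }
  allWithin : ∀ {T} → ℝ → (Fin T → ℝ) → Borel T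
  allWithin α v = Vector.foldr _∩_ whole
    (λ t → atLeast t (v t - α) ∩ atMost t (v t + α))

  -- On every input, with probability at least β, the output at every time
  -- step is within α of the weight of a minimum cut of the current graph.
  -- Minimum cuts exist only for graphs with at least two nodes, so nothing is
  -- required of sequences with a smaller graph.

  MinCutAccurate : ∀ {W T} → (α β : ℝ) → Algorithm W T → Set
  MinCutAccurate {T = T} α β 𝓐 =
    ∀ {n} (G : IncrementalSequence n _ T) (m : Fin T → ℕ) →
    (∀ t → IsMinCutWeight (nodesAt G t) (weightAt G t) (m t)) →
    β ≤ Pr (𝓐 G) (allWithin α (λ t → fromℕ (m t)))

{-# OPTIONS --safe #-}
module Submission where

-- Packing.  Start from a clique on k nodes and one isolated node, all edges of
-- weight W, and let G i join the isolated node to the clique by all k edges at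
-- time i.  The minimum cut weight of G i jumps from 0 to k W at time i, so if
-- the error α is below k W / 2, the events "all outputs are accurate for G i"
-- are pairwise disjoint.  Since G i is k edge insertions away from the sequence
-- without insertions, group privacy gives each of these T events probability at
-- least β e^(- k ε) under the output distribution on that one sequence, which is
-- impossible once k is a small enough multiple of log T.

open import Defs
open import Algebra.Bundles using (CommutativeRing)
import Algebra.Properties.Semiring.Mult as SemiringMult
open import Data.Bool.Base using (true; false; if_then_else_)
open import Data.Fin.Base as Fin using (Fin; zero; suc; toℕ; fromℕ<)
open import Data.Fin.Properties as Fin using (toℕ<n; toℕ-fromℕ<)
open import Data.Fin.Subset using (Subset; inside; outside; _∈_; _∉_; _─_; ⊤; ⊥; ⁅_⁆; ⋃)
open import Data.Fin.Subset.Properties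
  using (_∈?_; ∈⊤; ∉⊥; ⊆⊤; x∈⁅x⁆; x∈⁅y⁆⇒x≡y; x∈p∧x∉q⇒x∈p─q; ∪-zeroˡ)
open import Data.List.Base using ([]; _∷_; length; map; filter; allFin)
import Data.List.Membership.Propositional as List
open import Data.List.Membership.Propositional.Properties
  using (∈-filter⁺; ∈-filter⁻; ∈-allFin; ∈-length)
open import Data.List.Properties using (length-tabulate)
open import Data.List.Relation.Unary.All as All using (_∷_)
open import Data.List.Relation.Unary.Any using (here; there)
open import Data.List.Relation.Unary.Unique.Propositional using (Unique; _∷_)
open import Data.List.Relation.Unary.Unique.Propositional.Properties using (allFin⁺; filter⁺)
open import Data.Nat.Base as ℕ using (ℕ; zero; suc; z≤n)
open import Data.Nat.DivMod using (_/_; _%_; m/n*n≤m; m≥n⇒m/n>0; m≡m%n+[m/n]*n; m%n<n)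
open import Data.Nat.Induction using (<-wellFounded)
import Data.Nat.ListAction as List
open import Data.Nat.Logarithm using (⌊log₂_⌋; ⌊log₂⌋-mono-≤; ⌊log₂[2^n]⌋≡n)
open import Data.Nat.Logarithm.Core using (⌊log2⌋)
open import Data.Nat.Properties as ℕ using (_<?_)
open import Data.Nat.Tactic.RingSolver using (solve-∀)
open import Data.Product.Base using (∃; _×_; _,_; proj₁; proj₂)
open import Data.Sum.Base using (inj₁; inj₂)
open import Data.Unit.Base using (tt)
import Data.Vec.Base as Vec
import Data.Vec.Functional as Vector
open import Function.Base using (_∘_)
open import Function.Bundles using (_⇔_; mk⇔)
open import Induction.WellFounded using (Acc; acc)
open import Relation.Binary.Definitions using (tri<; tri≈; tri>)
open import Relation.Binary.PropositionalEquality
  using (_≡_; _≢_; refl; sym; trans; cong; cong₂; subst; subst₂; ≢-sym; module ≡-Reasoning)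
open import Relation.Nullary.Decidable using (dec-true; dec-false)
open import Relation.Nullary.Decidable.Core using (Dec; does; yes; no)
open import Relation.Nullary.Negation.Core using (¬_; contradiction)
open import Relation.Unary using (Decidable)

-- Sums over lists and lengths of filtered lists.

module _ {A : Set} where

  sum-const : ∀ (f : A → ℕ) {c} xs → (∀ {x} → x List.∈ xs → f x ≡ c) →
              List.sum (map f xs) ≡ length xs ℕ.* c
  sum-const f []       _  = refl
  sum-const f (x ∷ xs) eq = cong₂ ℕ._+_ (eq (here refl)) (sum-const f xs (eq ∘ there))

  sum-zero : ∀ (f : A → ℕ) xs → (∀ {x} → x List.∈ xs → f x ≡ 0) → List.sum (map f xs) ≡ 0
  sum-zero f xs eq = trans (sum-const f xs eq) (ℕ.*-zeroʳ (length xs))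

  sum-single : ∀ (f : A → ℕ) {y xs} → Unique xs → y List.∈ xs → (∀ x → x ≢ y → f x ≡ 0) →
               List.sum (map f xs) ≡ f y
  sum-single f (y∉ ∷ _) (here refl) f≡0 =
    trans (cong (f _ ℕ.+_) (sum-zero f _ λ x∈ → f≡0 _ (≢-sym (All.lookup y∉ x∈))))
          (ℕ.+-identityʳ _)
  sum-single f (x∉ ∷ xs!) (there y∈) f≡0 =
    cong₂ ℕ._+_ (f≡0 _ (All.lookup x∉ y∈)) (sum-single f xs! y∈ f≡0)

  -- Each element passes exactly one of the two filters. `Q` is kept separate from the negation of
  -- `P` because it will be membership in a set difference.
  length-filter-complement : ∀ {P Q : A → Set} (P? : Decidable P) (Q? : Decidable Q) →
    (∀ {x} → P x → ¬ Q x) → (∀ {x} → ¬ P x → Q x) → ∀ xs →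
    length (filter P? xs) ℕ.+ length (filter Q? xs) ≡ length xs
  length-filter-complement P? Q? P⇒¬Q ¬P⇒Q []       = refl
  length-filter-complement P? Q? P⇒¬Q ¬P⇒Q (x ∷ xs) with P? x | Q? x
  ... | yes _  | no _  = cong suc (length-filter-complement P? Q? P⇒¬Q ¬P⇒Q xs)
  ... | no _   | yes _ = trans (ℕ.+-suc _ _)
                           (cong suc (length-filter-complement P? Q? P⇒¬Q ¬P⇒Q xs))
  ... | yes p  | yes q = contradiction q (P⇒¬Q p)
  ... | no ¬p  | no ¬q = contradiction (¬P⇒Q ¬p) ¬q

-- Subsets of `Fin n` and their element lists.

x∈p─q⇒x∉q : ∀ {n x} (p q : Subset n) → x ∈ p ─ q → x ∉ q
x∈p─q⇒x∉q (_ Vec.∷ p) (inside  Vec.∷ q) (Vec.there x∈) (Vec.there x∈q) = x∈p─q⇒x∉q p q x∈ x∈q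
x∈p─q⇒x∉q (_ Vec.∷ p) (outside Vec.∷ q) (Vec.there x∈) (Vec.there x∈q) = x∈p─q⇒x∉q p q x∈ x∈q

∈-elements⁺ : ∀ {n x} (S : Subset n) → x ∈ S → x List.∈ elements S
∈-elements⁺ S x∈S = ∈-filter⁺ (_∈? S) (∈-allFin _) x∈S

∈-elements⁻ : ∀ {n x} (S : Subset n) → x List.∈ elements S → x ∈ S
∈-elements⁻ {n} S x∈ = proj₂ (∈-filter⁻ (_∈? S) {xs = allFin n} x∈)

length-elements-complement : ∀ {n} (S : Subset n) →
  length (elements S) ℕ.+ length (elements (⊤ ─ S)) ≡ n
length-elements-complement {n} S = trans
  (length-filter-complement (_∈? S) (_∈? (⊤ ─ S))
    (λ x∈S x∈⊤─S → x∈p─q⇒x∉q ⊤ S x∈⊤─S x∈S) (x∈p∧x∉q⇒x∈p─q ∈⊤) (allFin n))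
  (length-tabulate {n = n} (λ i → i))

-- The indicator `δ` of `x` is summed over the list in two ways: it is constantly 1 there, which
-- gives the length, and the list has no repetitions, which leaves one summand.
length-elements-singleton : ∀ {n} (x : Fin n) → length (elements ⁅ x ⁆) ≡ 1
length-elements-singleton {n} x = trans (sym (ℕ.*-identityʳ _)) (trans
  (sym (sum-const δ (elements ⁅ x ⁆) λ y∈ → δ≡1 (x∈⁅y⁆⇒x≡y x (∈-elements⁻ ⁅ x ⁆ y∈))))
  (trans (sum-single δ (filter⁺ (_∈? ⁅ x ⁆) (allFin⁺ n)) (∈-elements⁺ ⁅ x ⁆ (x∈⁅x⁆ x)) δ≡0)
    (δ≡1 refl)))
  where
  δ : Fin n → ℕ
  δ y = if does (y Fin.≟ x) then 1 else 0
  δ≡1 : ∀ {y} → y ≡ x → δ y ≡ 1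
  δ≡1 {y} y≡x rewrite dec-true (y Fin.≟ x) y≡x = refl
  δ≡0 : ∀ y → y ≢ x → δ y ≡ 0
  δ≡0 y y≢x rewrite dec-false (y Fin.≟ x) y≢x = refl

-- Minimum cuts with an isolated node and in complete graphs.

cutWeight-const : ∀ {n c} (w : Fin n → Fin n → ℕ) (V S : Subset n) →
  (∀ {u v} → u ∈ S → v ∈ V ─ S → w u v ≡ c) →
  cutWeight V w S ≡ length (elements S) ℕ.* (length (elements (V ─ S)) ℕ.* c)
cutWeight-const w V S eq = sum-const _ (elements S) λ u∈ →
  sum-const (w _) (elements (V ─ S)) λ v∈ → eq (∈-elements⁻ S u∈) (∈-elements⁻ (V ─ S) v∈)

module _ {k : ℕ} (w : Fin (suc (suc k)) → Fin (suc (suc k)) → ℕ) where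

  private
    isCut-zero : IsCut {suc (suc k)} ⊤ ⁅ zero ⁆
    isCut-zero = ⊆⊤ , (zero , x∈⁅x⁆ zero) ,
      (suc zero , x∈p∧x∉q⇒x∈p─q {p = ⊤} {q = ⁅ zero ⁆} ∈⊤
        (λ 1∈ → Fin.0≢1+n (sym (x∈⁅y⁆⇒x≡y zero 1∈))))

  -- Separating node `zero` costs nothing, and no natural number is below 0.
  minCut-isolated : (∀ v → w zero v ≡ 0) → IsMinCutWeight ⊤ w 0
  minCut-isolated w₀≡0 = (⁅ zero ⁆ , isCut-zero , cut≡0) , λ _ _ → z≤n
    where
    cut≡0 : cutWeight ⊤ w ⁅ zero ⁆ ≡ 0
    cut≡0 = sum-zero _ (elements ⁅ zero ⁆) λ u∈ → sum-zero _ (elements (⊤ ─ ⁅ zero ⁆)) λ {v} _ →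
      subst (λ u → w u v ≡ 0) (sym (x∈⁅y⁆⇒x≡y zero (∈-elements⁻ ⁅ zero ⁆ u∈))) (w₀≡0 v)

  -- A cut into s and r nodes has weight s r c, and s r ≥ s + r − 1.
  minCut-complete : ∀ {c} → (∀ u v → u ≢ v → w u v ≡ c) → IsMinCutWeight ⊤ w (suc k ℕ.* c)
  minCut-complete {c} w≡c = (⁅ zero ⁆ , isCut-zero , eq) , bound
    where
    cut≡ : ∀ S → cutWeight ⊤ w S ≡ length (elements S) ℕ.* (length (elements (⊤ ─ S)) ℕ.* c)
    cut≡ S = cutWeight-const w ⊤ S λ u∈S v∈ → w≡c _ _ λ { refl → x∈p─q⇒x∉q ⊤ S v∈ u∈S }
    eq : cutWeight ⊤ w ⁅ zero ⁆ ≡ suc k ℕ.* c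
    eq = begin
      cutWeight ⊤ w ⁅ zero ⁆ ≡⟨ cut≡ ⁅ zero ⁆ ⟩
      length (elements {suc (suc k)} ⁅ zero ⁆) ℕ.* (r ℕ.* c) ≡⟨ cong (ℕ._* (r ℕ.* c)) s≡1 ⟩
      1 ℕ.* (r ℕ.* c)            ≡⟨ ℕ.*-identityˡ (r ℕ.* c) ⟩
      r ℕ.* c                  ≡⟨ cong (ℕ._* c) r≡1+k ⟩
      suc k ℕ.* c              ∎
      where
      open ≡-Reasoning
      r : ℕ
      r = length (elements (⊤ {suc (suc k)} ─ ⁅ zero ⁆))
      s≡1 : length (elements {suc (suc k)} ⁅ zero ⁆) ≡ 1
      s≡1 = length-elements-singleton {suc (suc k)} zero
      r≡1+k : r ≡ suc k
      r≡1+k = ℕ.suc-injective (trans (cong (ℕ._+ r) (sym s≡1))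
        (length-elements-complement {suc (suc k)} ⁅ zero ⁆))
    k<sr : ∀ s r → 0 ℕ.< s → 0 ℕ.< r → s ℕ.+ r ≡ suc (suc k) → suc k ℕ.≤ s ℕ.* r
    k<sr (suc s) (suc r) _ _ s+r≡ = begin
      suc k           ≡⟨ ℕ.suc-injective s+r≡ ⟨
      s ℕ.+ suc r       ≤⟨ ℕ.+-monoˡ-≤ (suc r) (ℕ.m≤m*n s (suc r)) ⟩
      s ℕ.* suc r ℕ.+ suc r ≡⟨ ℕ.+-comm (s ℕ.* suc r) (suc r) ⟩
      suc s ℕ.* suc r   ∎
      where open ℕ.≤-Reasoning
    bound : ∀ S → IsCut ⊤ S → suc k ℕ.* c ℕ.≤ cutWeight ⊤ w S
    bound S (_ , (_ , u∈S) , (_ , v∈⊤─S)) = begin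
      suc k ℕ.* c ≤⟨ ℕ.*-monoˡ-≤ c (k<sr s r (∈-length (∈-elements⁺ S u∈S))
                     (∈-length (∈-elements⁺ (⊤ ─ S) v∈⊤─S)) (length-elements-complement S)) ⟩
      s ℕ.* r ℕ.* c ≡⟨ ℕ.*-assoc s r c ⟩
      s ℕ.* (r ℕ.* c) ≡⟨ cut≡ S ⟨
      cutWeight ⊤ w S ∎
      where
      open ℕ.≤-Reasoning
      s r : ℕ
      s = length (elements S)
      r = length (elements (⊤ ─ S))

-- The sequences: a clique, with a star inserted at a single time.

-- joinAt i j starts with the clique on the nodes 1, …, k and the isolated node 0,
-- and inserts at time i the edges from node 0 to the nodes 1, …, j.

module CliqueWithStar (W T k : ℕ) where

  cliqueWeight : Fin (suc k) → Fin (suc k) → ℕ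
  cliqueWeight (suc u) (suc v) = if does (u Fin.≟ v) then 0 else W
  cliqueWeight zero    _       = 0
  cliqueWeight (suc _) zero    = 0

  -- A threshold on `toℕ v`, so that raising `j` by one adds exactly one edge; this is what makes
  -- consecutive sequences edge-adjacent.
  spoke : ℕ → Fin k → ℕ
  spoke j v = if does (toℕ v <? j) then W else 0

  starWeight : ℕ → Fin (suc k) → Fin (suc k) → ℕ
  starWeight j zero    (suc v) = spoke j v
  starWeight j (suc u) zero    = spoke j u
  starWeight j zero    zero    = 0
  starWeight j (suc _) (suc _) = 0

  spoke-< : ∀ j v → toℕ v ℕ.< j → spoke j v ≡ W
  spoke-< j v v<j rewrite dec-true (toℕ v <? j) v<j = refl

  spoke-≮ : ∀ j v → ¬ toℕ v ℕ.< j → spoke j v ≡ 0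
  spoke-≮ j v v≮j rewrite dec-false (toℕ v <? j) v≮j = refl

  spoke-≤W : ∀ j v → spoke j v ℕ.≤ W
  spoke-≤W j v with toℕ v <? j
  ... | yes v<j = ℕ.≤-reflexive (spoke-< j v v<j)
  ... | no  v≮j = ℕ.≤-trans (ℕ.≤-reflexive (spoke-≮ j v v≮j)) z≤n

  spoke≢0⇒< : ∀ j v → spoke j v ≢ 0 → toℕ v ℕ.< j
  spoke≢0⇒< j v ≢0 with toℕ v <? j
  ... | yes v<j = v<j
  ... | no  v≮j = contradiction (spoke-≮ j v v≮j) ≢0

  clique : EdgeSet (suc k) W
  clique = record
    { weight    = cliqueWeight
    ; weight≤W  = ≤W
    ; symmetric = comm
    ; loopless  = loop
    }
    where
    ≤W : ∀ u v → cliqueWeight u v ℕ.≤ W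
    ≤W zero    _       = z≤n
    ≤W (suc u) zero    = z≤n
    ≤W (suc u) (suc v) with does (u Fin.≟ v)
    ... | true  = z≤n
    ... | false = ℕ.≤-refl
    comm : ∀ u v → cliqueWeight u v ≡ cliqueWeight v u
    comm zero    zero    = refl
    comm zero    (suc _) = refl
    comm (suc _) zero    = refl
    comm (suc u) (suc v) with u Fin.≟ v
    ... | yes refl rewrite dec-true (u Fin.≟ u) refl = refl
    ... | no  u≢v  rewrite dec-false (v Fin.≟ u) (≢-sym u≢v) = refl
    loop : ∀ u → cliqueWeight u u ≡ 0
    loop zero = refl
    loop (suc u) rewrite dec-true (u Fin.≟ u) refl = refl

  star : ℕ → EdgeSet (suc k) W
  star j = record
    { weight    = starWeight j
    ; weight≤W  = ≤W
    ; symmetric = comm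
    ; loopless  = λ { zero → refl ; (suc _) → refl }
    }
    where
    ≤W : ∀ u v → starWeight j u v ℕ.≤ W
    ≤W zero    zero    = z≤n
    ≤W zero    (suc v) = spoke-≤W j v
    ≤W (suc u) zero    = spoke-≤W j u
    ≤W (suc _) (suc _) = z≤n
    comm : ∀ u v → starWeight j u v ≡ starWeight j v u
    comm zero    zero    = refl
    comm zero    (suc _) = refl
    comm (suc _) zero    = refl
    comm (suc _) (suc _) = refl

  starWeight-0 : ∀ u v → starWeight 0 u v ≡ 0
  starWeight-0 zero    zero    = refl
  starWeight-0 zero    (suc _) = refl
  starWeight-0 (suc _) zero    = refl
  starWeight-0 (suc _) (suc _) = refl

  starWeight≢0⇒cliqueWeight≡0 : ∀ j u v → starWeight j u v ≢ 0 → cliqueWeight u v ≡ 0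
  starWeight≢0⇒cliqueWeight≡0 j zero    _       _  = refl
  starWeight≢0⇒cliqueWeight≡0 j (suc _) zero    _  = refl
  starWeight≢0⇒cliqueWeight≡0 j (suc _) (suc _) ≢0 = contradiction refl ≢0

  spoke≢0⇒≡suc : ∀ j v → spoke j v ≢ 0 → spoke j v ≡ spoke (suc j) v
  spoke≢0⇒≡suc j v ≢0 = trans (spoke-< j v v<j) (sym (spoke-< (suc j) v (ℕ.m≤n⇒m≤1+n v<j)))
    where
    v<j : toℕ v ℕ.< j
    v<j = spoke≢0⇒< j v ≢0

  starWeight≢0⇒≡suc : ∀ j u v → starWeight j u v ≢ 0 → starWeight j u v ≡ starWeight (suc j) u v
  starWeight≢0⇒≡suc j zero    zero    _  = refl
  starWeight≢0⇒≡suc j zero    (suc v) ≢0 = spoke≢0⇒≡suc j v ≢0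
  starWeight≢0⇒≡suc j (suc u) zero    ≢0 = spoke≢0⇒≡suc j u ≢0
  starWeight≢0⇒≡suc j (suc _) (suc _) _  = refl

  -- A spoke of weight 0 would be no edge, so a nonzero `W` is what turns `spoke j v ≡ 0` into
  -- `j ≤ toℕ v`.
  spoke-added : .{{_ : ℕ.NonZero W}} → ∀ j v → spoke (suc j) v ≢ 0 → spoke j v ≡ 0 → toℕ v ≡ j
  spoke-added j v ≢0 ≡0 = ℕ.≤-antisym (ℕ.s≤s⁻¹ (spoke≢0⇒< (suc j) v ≢0))
    (ℕ.≮⇒≥ λ v<j → ℕ.≢-nonZero⁻¹ W (trans (sym (spoke-< j v v<j)) ≡0))

  starWeight-added : .{{_ : ℕ.NonZero W}} → ∀ u v v* →
    (starWeight (suc (toℕ v*)) u v ≢ 0 × starWeight (toℕ v*) u v ≡ 0) ⇔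
    SameEdge u v zero (suc v*)
  starWeight-added u v v* = mk⇔ (to u v) from
    where
    to : ∀ u v → starWeight (suc (toℕ v*)) u v ≢ 0 × starWeight (toℕ v*) u v ≡ 0 →
         SameEdge u v zero (suc v*)
    to zero    zero    (≢0 , _)  = contradiction refl ≢0
    to zero    (suc v) (≢0 , ≡0) =
      inj₁ (refl , cong suc (Fin.toℕ-injective (spoke-added (toℕ v*) v ≢0 ≡0)))
    to (suc u) zero    (≢0 , ≡0) =
      inj₂ (cong suc (Fin.toℕ-injective (spoke-added (toℕ v*) u ≢0 ≡0)) , refl)
    to (suc _) (suc _) (≢0 , _)  = contradiction refl ≢0
    added : spoke (suc (toℕ v*)) v* ≢ 0 × spoke (toℕ v*) v* ≡ 0
    added = (λ ≡0 → ℕ.≢-nonZero⁻¹ W (trans (sym (spoke-< _ v* (ℕ.n<1+n _))) ≡0)) ,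
            spoke-≮ _ v* (ℕ.<-irrefl refl)
    from : ∀ {u v} → SameEdge u v zero (suc v*) →
           starWeight (suc (toℕ v*)) u v ≢ 0 × starWeight (toℕ v*) u v ≡ 0
    from (inj₁ (refl , refl)) = added
    from (inj₂ (refl , refl)) = added

  -- All `k` spokes complete the clique to a complete graph with uniform weights, the situation of
  -- `minCut-complete`.
  clique+star : ∀ u v → u ≢ v → cliqueWeight u v ℕ.+ starWeight k u v ≡ W
  clique+star zero    zero    u≢v = contradiction refl u≢v
  clique+star zero    (suc v) _   = spoke-< k v (toℕ<n v)
  clique+star (suc u) zero    _   = spoke-< k u (toℕ<n u)
  clique+star (suc u) (suc v) u≢v
    rewrite dec-false (u Fin.≟ v) (u≢v ∘ cong suc) = ℕ.+-identityʳ W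

  module _ (i : Fin T) (j : ℕ) where

    -- Every time step inserts a star; away from time `i` it has no spokes and is thus empty.
    spokesAt : Fin T → ℕ
    spokesAt t = if does (t Fin.≟ i) then j else 0

    spokesAt-≡ : spokesAt i ≡ j
    spokesAt-≡ rewrite dec-true (i Fin.≟ i) refl = refl

    spokesAt-≢ : ∀ {t} → t ≢ i → spokesAt t ≡ 0
    spokesAt-≢ {t} t≢i rewrite dec-false (t Fin.≟ i) t≢i = refl

    starWeight-≢ : ∀ t → t ≢ i → ∀ u v → starWeight (spokesAt t) u v ≡ 0
    starWeight-≢ t t≢i u v rewrite spokesAt-≢ t≢i = starWeight-0 u v

    starWeight≢0⇒≡ : ∀ t u v → starWeight (spokesAt t) u v ≢ 0 → t ≡ i
    starWeight≢0⇒≡ t u v ≢0 with t Fin.≟ i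
    ... | yes t≡i = t≡i
    ... | no  _   = contradiction (starWeight-0 u v) ≢0

    joinAt : IncrementalSequence (suc k) W T
    joinAt = record
      { V₀           = ⊤
      ; E₀           = clique
      ; ∂V           = λ _ → ⊥
      ; ∂E           = λ t → star (spokesAt t)
      ; E₀-endpoints = λ _ _ _ → ∈⊤
      ; ∂E-endpoints = λ t u _ _ → subst (u ∈_) (sym (∪-zeroˡ (⋃ (map (λ _ → ⊥) (upTo t))))) ∈⊤
      ; ∂V-fresh     = λ _ _ u∈⊥ → contradiction u∈⊥ ∉⊥
      -- Spokes are never clique edges, and an inserted edge forces `t` to be `i`, before which only
      -- empty stars are inserted.
      ; ∂E-fresh     = λ t u v ≢0 → starWeight≢0⇒cliqueWeight≡0 _ u v ≢0 ,
          λ s s<t → starWeight-≢ s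
            (λ s≡i → Fin.<-irrefl (trans s≡i (sym (starWeight≢0⇒≡ t u v ≢0))) s<t) u v
      }

    nodesAt-joinAt : ∀ t → nodesAt joinAt t ≡ ⊤
    nodesAt-joinAt t = ∪-zeroˡ (⋃ (map (λ _ → ⊥) (upTo t)))

    weightAt-before : ∀ {t} → t Fin.< i → ∀ v → weightAt joinAt t zero v ≡ 0
    weightAt-before {t} t<i v = sum-zero _ (upTo t) λ {s} s∈ → starWeight-≢ s
      (λ { refl → ℕ.<⇒≱ t<i (proj₂ (∈-filter⁻ (Fin._≤? t) {xs = allFin T} s∈)) }) zero v

    weightAt-after : ∀ {t} → i Fin.≤ t → ∀ u v →
                     weightAt joinAt t u v ≡ cliqueWeight u v ℕ.+ starWeight j u v
    weightAt-after {t} i≤t u v = cong (cliqueWeight u v ℕ.+_) (trans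
      (sum-single (λ s → starWeight (spokesAt s) u v) (filter⁺ (Fin._≤? t) (allFin⁺ T))
        (∈-filter⁺ (Fin._≤? t) (∈-allFin i) i≤t) (λ s s≢i → starWeight-≢ s s≢i u v))
      (cong (λ l → starWeight l u v) spokesAt-≡))

  spokesAt-0 : ∀ i t → spokesAt i 0 t ≡ 0
  spokesAt-0 i t with does (t Fin.≟ i)
  ... | true  = refl
  ... | false = refl

  -- The omitted edge is the last of the `suc j` spokes, the one to node `suc (fromℕ< j<k)`. The
  -- times `i` and `i′` may differ if the remaining spokes give the same insertions; this happens
  -- for `j` equal to 0.
  joinAt-omits : .{{_ : ℕ.NonZero W}} → ∀ i i′ {j} → j ℕ.< k →
    (∀ t → spokesAt i′ j t ≡ spokesAt i j t) → OmitsEdge (joinAt i (suc j)) (joinAt i′ j)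
  joinAt-omits i i′ {j} j<k same = record
    { same-V₀   = refl
    ; same-E₀   = λ _ _ → refl
    ; same-∂V   = λ _ → refl
    ; t*        = i
    ; u*        = zero
    ; v*        = suc (fromℕ< j<k)
    ; same-∂E   = λ t t≢i u v → trans (starWeight-≢ i (suc j) t t≢i u v)
                    (sym (trans (cong (λ l → starWeight l u v) (same t))
                      (starWeight-≢ i j t t≢i u v)))
    ; included  = included
    ; only-u*v* = only
    }
    where
    at-i : spokesAt i′ j i ≡ j
    at-i = trans (same i) (spokesAt-≡ i j)
    included : ∂E (joinAt i′ j) i ⊆ᴱ ∂E (joinAt i (suc j)) i
    included u v rewrite at-i | spokesAt-≡ i (suc j) = starWeight≢0⇒≡suc j u v
    only : ∀ u v → (u ─ v ∈ᴱ ∂E (joinAt i (suc j)) i × u ─ v ∉ᴱ ∂E (joinAt i′ j) i) ⇔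
                   SameEdge u v zero (suc (fromℕ< j<k))
    only u v rewrite at-i | spokesAt-≡ i (suc j) =
      subst (λ l → (starWeight (suc l) u v ≢ 0 × starWeight l u v ≡ 0) ⇔
                   SameEdge u v zero (suc (fromℕ< j<k)))
        (toℕ-fromℕ< j<k) (starWeight-added u v (fromℕ< j<k))

-- Minimum cut weights along the sequences.

module _ (W T k : ℕ) where

  open CliqueWithStar W T (suc k)

  minCutWeight : Fin T → Fin T → ℕ
  minCutWeight i t = if does (i Fin.≤? t) then suc k ℕ.* W else 0

  minCutWeight-before : ∀ {i t} → t Fin.< i → minCutWeight i t ≡ 0
  minCutWeight-before {i} {t} t<i rewrite dec-false (i Fin.≤? t) (ℕ.<⇒≱ t<i) = refl

  minCutWeight-after : ∀ {i t} → i Fin.≤ t → minCutWeight i t ≡ suc k ℕ.* W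
  minCutWeight-after {i} {t} i≤t rewrite dec-true (i Fin.≤? t) i≤t = refl

  -- Before time `i` node `zero` is isolated; from time `i` on the graph is complete on
  -- `suc (suc k)` nodes with all weights `W`.
  minCutWeight-isMinCutWeight : ∀ i t →
    let G = joinAt i (suc k) in IsMinCutWeight (nodesAt G t) (weightAt G t) (minCutWeight i t)
  minCutWeight-isMinCutWeight i t =
    subst (λ V → IsMinCutWeight V (weightAt G t) (minCutWeight i t))
      (sym (nodesAt-joinAt i (suc k) t)) (by-cases (i Fin.≤? t))
    where
    G : IncrementalSequence (suc (suc k)) W T
    G = joinAt i (suc k)
    by-cases : Dec (i Fin.≤ t) → IsMinCutWeight ⊤ (weightAt G t) (minCutWeight i t)
    by-cases (yes i≤t) = subst (IsMinCutWeight ⊤ (weightAt G t))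
      (sym (minCutWeight-after {i} {t} i≤t))
      (minCut-complete (weightAt G t) λ u v u≢v →
        trans (weightAt-after i (suc k) {t} i≤t u v) (clique+star u v u≢v))
    by-cases (no  i≰t) = subst (IsMinCutWeight ⊤ (weightAt G t))
      (sym (minCutWeight-before {i} {t} (ℕ.≰⇒> i≰t)))
      (minCut-isolated (weightAt G t) (weightAt-before i (suc k) {t} (ℕ.≰⇒> i≰t)))

-- Logarithms and the choice of the number of spokes.

-- `⌊log2⌋` recurses by halving: its value at `suc (suc n)` is one more than at `suc ⌊n/2⌋`, and
-- twice that argument is at most `suc (suc n)`.
2^⌊log₂n⌋≤n : ∀ n → 2 ℕ.^ ⌊log₂ suc n ⌋ ℕ.≤ suc n
2^⌊log₂n⌋≤n n = go n (<-wellFounded (suc n))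
  where
  go : ∀ n (rec : Acc ℕ._<_ (suc n)) → 2 ℕ.^ ⌊log2⌋ (suc n) rec ℕ.≤ suc n
  go zero    _        = ℕ.≤-refl
  go (suc n) (acc rs) = begin
    2 ℕ.* 2 ℕ.^ ⌊log2⌋ (suc ⌊n/2⌋) _ ≤⟨ ℕ.*-monoʳ-≤ 2 (go ⌊n/2⌋ _) ⟩
    2 ℕ.* suc ⌊n/2⌋                 ≡⟨ cong (suc ⌊n/2⌋ ℕ.+_) (ℕ.+-identityʳ (suc ⌊n/2⌋)) ⟩
    suc ⌊n/2⌋ ℕ.+ suc ⌊n/2⌋         ≤⟨ ℕ.+-monoʳ-≤ (suc ⌊n/2⌋) (ℕ.⌊n/2⌋≤⌈n/2⌉ (suc (suc n))) ⟩
    suc ⌊n/2⌋ ℕ.+ ℕ.⌈ suc (suc n) /2⌉ ≡⟨ ℕ.⌊n/2⌋+⌈n/2⌉≡n (suc (suc n)) ⟩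
    suc (suc n)                     ∎
    where
    open ℕ.≤-Reasoning
    ⌊n/2⌋ : ℕ
    ⌊n/2⌋ = ℕ.⌊ n /2⌋

n<2^n : ∀ n → n ℕ.< 2 ℕ.^ n
n<2^n zero    = ℕ.s≤s ℕ.z≤n
n<2^n (suc n) = begin
  suc (suc n)           ≤⟨ ℕ.+-mono-≤ (ℕ.m^n>0 2 n) (n<2^n n) ⟩
  2 ℕ.^ n ℕ.+ 2 ℕ.^ n   ≡⟨ cong (2 ℕ.^ n ℕ.+_) (ℕ.+-identityʳ (2 ℕ.^ n)) ⟨
  2 ℕ.^ suc n           ∎
  where open ℕ.≤-Reasoning

-- The number of edges that are inserted at once; Q will exceed both e^ε and 2 / β.
spokeCount : ∀ Q .{{_ : ℕ.NonZero Q}} T → 2 ℕ.^ (2 ℕ.* Q) ℕ.≤ T →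
  ∃ λ k → Q ℕ.^ suc k ℕ.* Q ℕ.≤ T × ⌊log₂ T ⌋ ℕ.≤ 4 ℕ.* Q ℕ.* suc k
spokeCount Q zero    2^≤T = contradiction 2^≤T (ℕ.<⇒≱ (ℕ.m^n>0 2 (2 ℕ.* Q)))
spokeCount Q T@(suc T-1) 2^≤T = go (L / d) refl (m≥n⇒m/n>0 d≤L)
  where
  open ℕ.≤-Reasoning
  L d : ℕ
  L = ⌊log₂ T ⌋
  -- The number of spokes will be `L / d`. Since `Q` is at most `2 ^ Q`, each power of `Q` costs `Q`
  -- binary digits; the factor 2 pays for the extra `Q` beside `Q ^ suc k`.
  d = 2 ℕ.* Q
  instance
    d≢0 : ℕ.NonZero d
    d≢0 = ℕ.m*n≢0 2 Q
  d≤L : d ℕ.≤ L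
  d≤L = ℕ.≤-trans (ℕ.≤-reflexive (sym (⌊log₂[2^n]⌋≡n d))) (⌊log₂⌋-mono-≤ 2^≤T)
  -- The quotient is positive because `d≤L`, so it can be matched as `suc k`.
  go : ∀ k → L / d ≡ k → 0 ℕ.< k →
       ∃ λ k → Q ℕ.^ suc k ℕ.* Q ℕ.≤ T × L ℕ.≤ 4 ℕ.* Q ℕ.* suc k
  go (suc k) L/d≡ _ = k , Q^k*Q≤T , L≤
    where
    Q^k*Q≤T : Q ℕ.^ suc k ℕ.* Q ℕ.≤ T
    Q^k*Q≤T = begin
      Q ℕ.^ suc k ℕ.* Q                  ≤⟨ ℕ.*-monoʳ-≤ (Q ℕ.^ suc k)
                                              (ℕ.m≤m*n Q (Q ℕ.^ k) {{ℕ.m^n≢0 Q k}}) ⟩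
      Q ℕ.^ suc k ℕ.* Q ℕ.^ suc k        ≡⟨ ℕ.^-distribˡ-+-* Q (suc k) (suc k) ⟨
      Q ℕ.^ (suc k ℕ.+ suc k)            ≤⟨ ℕ.^-monoˡ-≤ (suc k ℕ.+ suc k) (ℕ.<⇒≤ (n<2^n Q)) ⟩
      (2 ℕ.^ Q) ℕ.^ (suc k ℕ.+ suc k)    ≡⟨ ℕ.^-*-assoc 2 Q (suc k ℕ.+ suc k) ⟩
      2 ℕ.^ (Q ℕ.* (suc k ℕ.+ suc k))    ≡⟨ cong (2 ℕ.^_) (double Q (suc k)) ⟩
      2 ℕ.^ (suc k ℕ.* d)                ≡⟨ cong (λ l → 2 ℕ.^ (l ℕ.* d)) L/d≡ ⟨
      2 ℕ.^ (L / d ℕ.* d)                ≤⟨ ℕ.^-monoʳ-≤ 2 (m/n*n≤m L d) ⟩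
      2 ℕ.^ L                            ≤⟨ 2^⌊log₂n⌋≤n T-1 ⟩
      T                                  ∎
      where
      double : ∀ q l → q ℕ.* (l ℕ.+ l) ≡ l ℕ.* (2 ℕ.* q)
      double = solve-∀
    L≤ : L ℕ.≤ 4 ℕ.* Q ℕ.* suc k
    L≤ = begin
      L                                ≡⟨ m≡m%n+[m/n]*n L d ⟩
      -- Rounding loses at most a factor 2: the remainder is below `d`, and the quotient is at least
      -- 1.
      L % d ℕ.+ L / d ℕ.* d            ≤⟨ ℕ.+-monoˡ-≤ _ (ℕ.<⇒≤ (m%n<n L d)) ⟩
      d ℕ.+ L / d ℕ.* d                ≡⟨ cong (λ l → d ℕ.+ l ℕ.* d) L/d≡ ⟩
      d ℕ.+ suc k ℕ.* d                ≤⟨ ℕ.+-monoˡ-≤ (suc k ℕ.* d) (ℕ.m≤n*m d (suc k)) ⟩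
      suc k ℕ.* d ℕ.+ suc k ℕ.* d      ≡⟨ quadruple Q (suc k) ⟩
      4 ℕ.* Q ℕ.* suc k                ∎
      where
      quadruple : ∀ q l → l ℕ.* (2 ℕ.* q) ℕ.+ l ℕ.* (2 ℕ.* q) ≡ 4 ℕ.* q ℕ.* l
      quadruple = solve-∀

-- Ordered-field arithmetic and partial sums.

module RealProperties (R : RealNumbers) where
  open RealNumbers R
  open OrderProperties R
  open SemiringMult (CommutativeRing.semiring commutativeRing) public
    using () renaming (×1-homo-* to fromℕ-*)
  open SemiringMult (CommutativeRing.semiring commutativeRing) using (×-homo-+)
  open import Relation.Binary.Reasoning.Setoid setoid

  +-mono-≤ : ∀ {x y u v} → x ≤ y → u ≤ v → x + u ≤ y + v
  +-mono-≤ {y = y} {u} x≤y u≤v = ≤-trans (+-monoˡ-≤ u x≤y) (+-monoʳ-≤ y u≤v)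

  +-mono-< : ∀ {x y u v} → x < y → u < v → x + u < y + v
  +-mono-< {y = y} {u} x<y u<v = <-trans (+-monoˡ-< u x<y) (+-monoʳ-< y u<v)

  *-cancelˡ-< : ∀ {x y z} → 0# < x → x * y < x * z → y < z
  *-cancelˡ-< {x} 0<x xy<xz with inverse 0<x
  ... | x⁻¹ , xx⁻¹≈1 = <-respˡ (cancel _) (<-respʳ (cancel _)
          (*-monoʳ-< (inverse-pos 0<x xx⁻¹≈1) xy<xz))
    where
    cancel : ∀ y → x⁻¹ * (x * y) ≈ y
    cancel y = begin
      x⁻¹ * (x * y) ≈⟨ *-assoc x⁻¹ x y ⟨
      x⁻¹ * x * y   ≈⟨ *-congʳ (≈-trans (*-comm x⁻¹ x) xx⁻¹≈1) ⟩
      1# * y        ≈⟨ *-identityˡ y ⟩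
      y             ∎

  -- The contrapositive of cancellation, since `≤` is a negated `<`.
  *-monoʳ-≤ : ∀ {x y z} → 0# < x → y ≤ z → x * y ≤ x * z
  *-monoʳ-≤ 0<x y≤z xz<xy = y≤z (*-cancelˡ-< 0<x xz<xy)

  -- In its application `x` is a probability and may vanish, so the strictness sits in `y < z`: the
  -- positive difference of `z` and `y` can be multiplied into `0# ≤ x`.
  *-monoˡ-≤ : ∀ {x y z} → 0# ≤ x → y < z → y * x ≤ z * x
  *-monoˡ-≤ {x} {y} {z} 0≤x y<z = ≤-trans (≤-reflexive (≈-sym (+-identityʳ (y * x))))
    (≤-trans (+-monoʳ-≤ (y * x) 0≤[z-y]x) (≤-reflexive eq))
    where
    0<z-y : 0# < - y + z
    0<z-y = <-respˡ (-‿inverseˡ y) (+-monoʳ-< (- y) y<z)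
    0≤[z-y]x : 0# ≤ (- y + z) * x
    0≤[z-y]x = ≤-trans (≤-reflexive (≈-sym (zeroʳ (- y + z)))) (*-monoʳ-≤ 0<z-y 0≤x)
    eq : y * x + (- y + z) * x ≈ z * x
    eq = ≈-trans (≈-sym (distribʳ x y (- y + z)))
      (*-congʳ (≈-trans (≈-sym (+-assoc y (- y) z))
        (≈-trans (+-congʳ (-‿inverseʳ y)) (+-identityˡ z))))

  fromℕ-mono-≤ : ∀ {m n} → m ℕ.≤ n → fromℕ m ≤ fromℕ n
  fromℕ-mono-≤ m≤n n<m with ℕ.m≤n⇒m<n∨m≡n m≤n
  ... | inj₁ m<n  = <⇒≤ (fromℕ-mono-< m<n) n<m
  ... | inj₂ refl = <-irrefl ≈-refl n<m

  fromℕ-+ : ∀ m n → fromℕ (m ℕ.+ n) ≈ fromℕ m + fromℕ n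
  fromℕ-+ = ×-homo-+ 1#

  0<fromℕ : ∀ n .{{_ : ℕ.NonZero n}} → 0# < fromℕ n
  0<fromℕ (suc n) = 0<1+n n

  fromℕ-unbounded : ∀ x y → ∃ λ n → ℕ.NonZero n × x < fromℕ n × y < fromℕ n
  fromℕ-unbounded x y with archimedean x | archimedean y
  ... | m , x<m | n , y<n = suc (m ℕ.+ n) , _ ,
    <-trans x<m (fromℕ-mono-< (ℕ.s≤s (ℕ.m≤m+n m n))) ,
    <-trans y<n (fromℕ-mono-< (ℕ.s≤s (ℕ.m≤n+m n m)))

  module _ {f : ℕ → ℝ} where

    partialSum-mono : (∀ i → 0# ≤ f i) → ∀ {m n} → m ℕ.≤′ n → partialSum f m ≤ partialSum f n
    partialSum-mono 0≤f ℕ.≤′-refl     = ≤-refl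
    partialSum-mono 0≤f (ℕ.≤′-step p) = ≤-trans (partialSum-mono 0≤f p)
      (≤-trans (≤-reflexive (≈-sym (+-identityʳ _))) (+-monoʳ-≤ _ (0≤f _)))

    -- The factor `κ` stays on the right instead of dividing `β`, which is the shape that group
    -- privacy provides.
    partialSum-lowerBound : ∀ {κ β} n → (∀ i → i ℕ.< n → β ≤ κ * f i) →
                            fromℕ n * β ≤ κ * partialSum f n
    partialSum-lowerBound {κ} {β} zero    _    =
      ≤-reflexive (≈-trans (zeroˡ β) (≈-sym (zeroʳ κ)))
    partialSum-lowerBound {κ} {β} (suc n) β≤κf = ≤-trans
      (≤-reflexive (≈-trans (distribʳ β 1# (fromℕ n))
        (≈-trans (+-congʳ (*-identityˡ β)) (+-comm β _))))
      (≤-trans (+-mono-≤ (partialSum-lowerBound n λ i i<n → β≤κf i (ℕ.m<n⇒m<1+n i<n))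
                         (β≤κf n (ℕ.n<1+n n)))
        (≤-reflexive (≈-sym (distribˡ κ _ _))))

  -- Probability measures and packing of disjoint events.

  module _ {T : ℕ} where
    open ContinualRelease R

    x∉∁whole : ∀ (x : Fin T → ℝ) → ¬ (x ∈ᴮ ∁ whole)
    x∉∁whole _ ¬tt = ¬tt tt

    -- Monotonicity applied to the empty event `∁ whole`.
    Pr≥0 : ∀ (μ : ProbabilityMeasure T) A → 0# ≤ Pr μ A
    Pr≥0 μ A = ≤-trans (≤-reflexive (≈-sym Pr-empty))
      (Pr-mono (∁ whole) A λ x x∈ → contradiction x∈ (x∉∁whole x))
      where open ProbabilityMeasure μ using (Pr-empty; Pr-mono)

    Disjoint : Borel T → Borel T → Set
    Disjoint A B = ∀ x → x ∈ᴮ A → ¬ (x ∈ᴮ B)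

    -- The factor 1 + 1 leaves room for a partial sum to exceed its limit.
    packing : ∀ (μ : ProbabilityMeasure T) {N} (A : Fin N → Borel T) →
      (∀ i j → i ≢ j → Disjoint (A i) (A j)) →
      ∀ {κ β} → 0# < κ → (∀ i → β ≤ κ * Pr μ (A i)) → fromℕ N * β ≤ κ * (1# + 1#)
    packing μ {N} A disjoint {κ} {β} 0<κ β≤κPr =
      ≤-trans (partialSum-lowerBound N lower) (*-monoʳ-≤ 0<κ sum≤2)
      where
      open ProbabilityMeasure μ using (Pr-mono; Pr-whole; Pr-additive)
      -- Additivity concerns infinite sequences of events, so the finite family is padded with empty
      -- ones.
      extendBy : ∀ {i} → Dec (i ℕ.< N) → Borel T
      extendBy (yes i<N) = A (fromℕ< i<N)
      extendBy (no  _)   = ∁ whole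
      extension : ℕ → Borel T
      extension i = extendBy (i <? N)
      extension-disjoint : ∀ i j → i ≢ j → Disjoint (extension i) (extension j)
      extension-disjoint i j i≢j x with i <? N | j <? N
      ... | yes i<N | yes j<N = disjoint _ _ (i≢j ∘ Fin.fromℕ<-injective i j i<N j<N) x
      ... | yes _   | no _    = λ _ → x∉∁whole x
      ... | no _    | _       = λ x∈ → contradiction x∈ (x∉∁whole x)
      lower : ∀ i → i ℕ.< N → β ≤ κ * Pr μ (extension i)
      lower i i<N with i <? N
      ... | yes _   = β≤κPr _
      ... | no  i≮N = contradiction i<N i≮N
      S : ℕ → ℝ
      S = partialSum (λ i → Pr μ (extension i))
      limit : ConvergesTo S (Pr μ (⋃ℕ extension))
      limit = Pr-additive extension extension-disjoint
      sum≤2 : S N ≤ 1# + 1#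
      -- With tolerance 1, a late partial sum is at most the limit plus 1, and the limit is itself a
      -- probability.
      sum≤2 with limit 1# 0<1
      ... | M , near = ≤-trans
        (partialSum-mono (λ i → Pr≥0 μ (extension i)) (ℕ.≤⇒≤′ (ℕ.m≤n⊔m M N)))
        (≤-trans (proj₁ (near (M ℕ.⊔ N) (ℕ.m≤m⊔n M N)))
          (+-monoˡ-≤ 1# (≤-trans (Pr-mono (⋃ℕ extension) whole _) (≤-reflexive Pr-whole))))

    ∈-foldr-∩ : ∀ {n} (A : Fin n → Borel T) {x} →
      x ∈ᴮ Vector.foldr _∩_ whole A → ∀ i → x ∈ᴮ A i
    ∈-foldr-∩ A (x∈ , _)  zero    = x∈
    ∈-foldr-∩ A (_  , x∈) (suc i) = ∈-foldr-∩ (A ∘ suc) x∈ i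

    -- A common point would give `v t - α ≤ x t ≤ u t + α`, whereas the centres are more than
    -- `α + α` apart.
    allWithin-disjoint : ∀ {α} {u v : Fin T → ℝ} t → u t + (α + α) < v t →
      Disjoint (allWithin α u) (allWithin α v)
    allWithin-disjoint {α} {u} {v} t gap x x∈u x∈v =
      ≤-trans (proj₁ (∈-foldr-∩ _ x∈v t)) (proj₂ (∈-foldr-∩ _ x∈u t))
        (<-respˡ shift (+-monoˡ-< (- α) gap))
      where
      shift : u t + (α + α) + - α ≈ u t + α
      shift = begin
        u t + (α + α) + - α   ≈⟨ +-assoc (u t) (α + α) (- α) ⟩
        u t + (α + α + - α)   ≈⟨ +-congˡ (+-assoc α α (- α)) ⟩
        u t + (α + (α + - α)) ≈⟨ +-congˡ (+-congˡ (-‿inverseʳ α)) ⟩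
        u t + (α + 0#)        ≈⟨ +-congˡ (+-identityʳ α) ⟩
        u t + α               ∎

-- Group privacy and the lower bound on the error.

module LowerBound (R : RealNumbers) where
  open RealNumbers R
  open OrderProperties R
  open RealProperties R
  open ContinualRelease R
  open Exponential R
  open import Relation.Binary.Reasoning.Setoid setoid

  module _ {ε : ℝ} {0<ε : 0# < ε} {Q : ℕ} (e<Q : exp ε 0<ε < fromℕ Q) .{{_ : ℕ.NonZero Q}}
           {W T : ℕ} .{{_ : ℕ.NonZero W}} (𝓐 : Algorithm W T)
           (dp : EdgeDifferentiallyPrivate ε 0<ε 𝓐) where

    -- Replacing the exponential by the natural number `Q` turns the group privacy factors into
    -- natural powers.
    adjacent-Pr : ∀ {n} (G G′ : IncrementalSequence n W T) → OmitsEdge G G′ →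
      ∀ S → Pr (𝓐 G) S ≤ fromℕ Q * Pr (𝓐 G′) S
    adjacent-Pr G G′ omits S = ≤-trans (dp G G′ (inj₁ omits) S)
      (*-monoˡ-≤ (Pr≥0 (𝓐 G′) S) e<Q)

    module _ {k : ℕ} where
      open CliqueWithStar W T k

      -- Inserting no edges at time i is the same as inserting none at time i₀, so
      -- the last step of the chain of adjacent sequences may change the time.
      group-Pr : ∀ i i₀ j → j ℕ.< k → ∀ S →
        Pr (𝓐 (joinAt i (suc j))) S ≤ fromℕ (Q ℕ.^ suc j) * Pr (𝓐 (joinAt i₀ 0)) S
      group-Pr i i₀ zero    j<k S = ≤-trans
        (adjacent-Pr _ _
          (joinAt-omits i i₀ j<k λ t → trans (spokesAt-0 i₀ t) (sym (spokesAt-0 i t))) S)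
        (≤-reflexive (*-congʳ (≈-sym (≈-trans (fromℕ-* Q 1)
          (≈-trans (*-congˡ (+-identityʳ 1#)) (*-identityʳ (fromℕ Q)))))))
      group-Pr i i₀ (suc j) j<k S = ≤-trans
        (adjacent-Pr _ _ (joinAt-omits i i j<k λ _ → refl) S)
        (≤-trans (*-monoʳ-≤ (0<fromℕ Q) (group-Pr i i₀ j (ℕ.<-trans (ℕ.n<1+n j) j<k) S))
          (≤-reflexive (≈-trans (≈-sym (*-assoc (fromℕ Q) (fromℕ (Q ℕ.^ suc j)) _))
            (*-congʳ (≈-sym (fromℕ-* Q (Q ℕ.^ suc j)))))))

    module _ {α β : ℝ} (accurate : MinCutAccurate α β 𝓐) where

      -- Accuracy on `joinAt i (suc k)` and group privacy over `suc k` edges bound every event from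
      -- below under the single sequence `joinAt i₀ 0`, which inserts nothing; the events are
      -- disjoint, so packing applies.
      sequences-bound : ∀ k → Fin T → α + α < fromℕ (suc k ℕ.* W) →
        fromℕ T * β ≤ fromℕ (Q ℕ.^ suc k) * (1# + 1#)
      sequences-bound k i₀ 2α<[1+k]W = packing (𝓐 (joinAt i₀ 0)) event event-disjoint
        (0<fromℕ (Q ℕ.^ suc k) {{ℕ.m^n≢0 Q (suc k)}})
        λ i → ≤-trans
          (accurate (joinAt i (suc k)) (minCutWeight W T k i)
            (minCutWeight-isMinCutWeight W T k i))
          (group-Pr {suc k} i i₀ k (ℕ.n<1+n k) (event i))
        where
        open CliqueWithStar W T (suc k)
        v : Fin T → Fin T → ℝ
        v i t = fromℕ (minCutWeight W T k i t)
        event : Fin T → Borel T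
        event i = allWithin α (v i)
        -- At time `i` the sequence joining at `i` has already jumped, while the one joining at the
        -- later time `j` still has a cut of weight 0.
        earlier-gap : ∀ {i j} → i Fin.< j → v j i + (α + α) < v i i
        earlier-gap {i} {j} i<j = subst₂ (λ m m′ → fromℕ m + (α + α) < fromℕ m′)
          (sym (minCutWeight-before W T k i<j)) (sym (minCutWeight-after W T k {i} {i} ℕ.≤-refl))
          (<-respˡ (≈-sym (+-identityˡ (α + α))) 2α<[1+k]W)
        event-disjoint : ∀ i j → i ≢ j → Disjoint (event i) (event j)
        event-disjoint i j i≢j x x∈i x∈j with Fin.<-cmp i j
        ... | tri< i<j _ _ = allWithin-disjoint {α = α} {v j} {v i} i (earlier-gap i<j) x x∈j x∈i
        ... | tri≈ _ i≡j _ = contradiction i≡j i≢j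
        ... | tri> _ _ j<i = allWithin-disjoint {α = α} {v i} {v j} j (earlier-gap j<i) x x∈i x∈j

    module _ {β : ℝ} (0<β : 0# < β) (2<Qβ : 1# + 1# < fromℕ Q * β) where

      -- The reciprocal of the final constant: `4 Q` comes from `spokeCount`, the factor 2 from the
      -- error on both sides of the gap.
      D : ℕ
      D = 2 ℕ.* (4 ℕ.* Q)

      -- An error below the bound makes `α + α` smaller than the jump `suc k * W`, so
      -- `sequences-bound` applies; but `T` was large enough for `spokeCount` to make its conclusion
      -- fail.
      error-bound : 2 ℕ.^ (2 ℕ.* Q) ℕ.≤ T → ∀ {c α} → 0# < c → fromℕ D * c ≈ 1# →
        MinCutAccurate α β 𝓐 → c * fromℕ (W ℕ.* ⌊log₂ T ⌋) ≤ α
      error-bound T₀≤T {c} {α} 0<c Dc≈1 accurate α<cWL with spokeCount Q T T₀≤T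
      ... | k , Q^k*Q≤T , L≤4Qk =
        sequences-bound accurate k (fromℕ< (ℕ.≤-trans (ℕ.m^n>0 2 (2 ℕ.* Q)) T₀≤T)) 2α<kW 2Q^k<Tβ
        where
        K : ℕ
        K = Q ℕ.^ suc k
        -- The extra factor `Q` in `Q^k*Q≤T` is spent here, through `2<Qβ`.
        2Q^k<Tβ : fromℕ K * (1# + 1#) < fromℕ T * β
        2Q^k<Tβ = <-≤-trans
          (<-respʳ
            (≈-trans (≈-sym (*-assoc (fromℕ K) (fromℕ Q) β)) (*-congʳ (≈-sym (fromℕ-* K Q))))
            (*-monoʳ-< (0<fromℕ K {{ℕ.m^n≢0 Q (suc k)}}) 2<Qβ))
          (≤-trans (≤-reflexive (*-comm (fromℕ (K ℕ.* Q)) β))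
            (≤-trans (*-monoʳ-≤ 0<β (fromℕ-mono-≤ Q^k*Q≤T)) (≤-reflexive (*-comm β (fromℕ T)))))
        X : ℕ
        X = W ℕ.* (4 ℕ.* Q ℕ.* suc k)
        α<cX : α < c * fromℕ X
        α<cX = <-≤-trans α<cWL
          (*-monoʳ-≤ 0<c (fromℕ-mono-≤ (ℕ.*-monoʳ-≤ W L≤4Qk)))
        X+X≡ : ∀ w q l →
          w ℕ.* (4 ℕ.* q ℕ.* l) ℕ.+ w ℕ.* (4 ℕ.* q ℕ.* l) ≡ 2 ℕ.* (4 ℕ.* q) ℕ.* (l ℕ.* w)
        X+X≡ = solve-∀
        2α<kW : α + α < fromℕ (suc k ℕ.* W)
        2α<kW = <-respʳ
          (begin
            c * fromℕ X + c * fromℕ X              ≈⟨ distribˡ c (fromℕ X) (fromℕ X) ⟨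
            c * (fromℕ X + fromℕ X)                ≈⟨ *-congˡ (fromℕ-+ X X) ⟨
            c * fromℕ (X ℕ.+ X)                    ≡⟨ cong (λ n → c * fromℕ n) (X+X≡ W Q (suc k)) ⟩
            c * fromℕ (D ℕ.* (suc k ℕ.* W))        ≈⟨ *-congˡ (fromℕ-* D (suc k ℕ.* W)) ⟩
            c * (fromℕ D * fromℕ (suc k ℕ.* W))    ≈⟨ *-assoc c (fromℕ D) (fromℕ (suc k ℕ.* W)) ⟨
            c * fromℕ D * fromℕ (suc k ℕ.* W)      ≈⟨ *-congʳ (≈-trans (*-comm c (fromℕ D)) Dc≈1) ⟩
            1# * fromℕ (suc k ℕ.* W)               ≈⟨ *-identityˡ (fromℕ (suc k ℕ.* W)) ⟩
            fromℕ (suc k ℕ.* W)                    ∎)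
          (+-mono-< α<cX α<cX)

-- Both the constant 1 / (8 `Q`) and the threshold `2 ^ (2 * Q)` depend only on `ε` and `β`, since
-- `Q` is chosen above e^ε and 2 / `β`.
theorem33 : (R : RealNumbers) →
    let open RealNumbers R
        open ContinualRelease R
    in
    (ε : ℝ) (0<ε : 0# < ε) (β : ℝ) → 0# < β →
    ∃ λ (c : ℝ) → 0# < c × ∃ λ (T₀ : ℕ) →
      (T W : ℕ) → T₀ ℕ.≤ T → 1 ℕ.≤ W →
      (𝓐 : Algorithm W T) → EdgeDifferentiallyPrivate ε 0<ε 𝓐 →
      (α : ℝ) → MinCutAccurate α β 𝓐 →
      c * fromℕ (W ℕ.* ⌊log₂ T ⌋) ≤ α
theorem33 R ε 0<ε β 0<β = c , 0<c , 2 ℕ.^ (2 ℕ.* Q) , λ T W T₀≤T 1≤W 𝓐 dp α accurate →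
  error-bound {ε} {0<ε} {Q} e<Q {W} {T} {{ℕ.>-nonZero 1≤W}} 𝓐 dp {β} 0<β 2<Qβ
    T₀≤T {c} {α} 0<c Dc≈1 accurate
  where
  open RealNumbers R
  open OrderProperties R
  open RealProperties R
  open ContinualRelease R
  open Exponential R
  open LowerBound R
  β⁻¹ : ℝ
  β⁻¹ = proj₁ (inverse 0<β)
  abstract
    constants : ∃ λ Q → ℕ.NonZero Q × exp ε 0<ε < fromℕ Q × (1# + 1#) * β⁻¹ < fromℕ Q
    constants = fromℕ-unbounded (exp ε 0<ε) ((1# + 1#) * β⁻¹)
  Q : ℕ
  Q = proj₁ constants
  instance
    Q≢0 : ℕ.NonZero Q
    Q≢0 = proj₁ (proj₂ constants)
    4Q≢0 : ℕ.NonZero (4 ℕ.* Q)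
    4Q≢0 = ℕ.m*n≢0 4 Q
  e<Q : exp ε 0<ε < fromℕ Q
  e<Q = proj₁ (proj₂ (proj₂ constants))
  2<Qβ : 1# + 1# < fromℕ Q * β
  2<Qβ = <-respˡ
    (≈-trans (*-assoc (1# + 1#) β⁻¹ β)
      (≈-trans (*-congˡ (≈-trans (*-comm β⁻¹ β) (proj₂ (inverse 0<β)))) (*-identityʳ (1# + 1#))))
    (*-monoˡ-< 0<β (proj₂ (proj₂ (proj₂ constants))))
  0<D : 0# < fromℕ (2 ℕ.* (4 ℕ.* Q))
  0<D = 0<fromℕ (2 ℕ.* (4 ℕ.* Q)) {{ℕ.m*n≢0 2 (4 ℕ.* Q)}}
  c : ℝ
  c = proj₁ (inverse 0<D)
  Dc≈1 : fromℕ (2 ℕ.* (4 ℕ.* Q)) * c ≈ 1#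
  Dc≈1 = proj₂ (inverse 0<D)
  0<c : 0# < c
  0<c = inverse-pos 0<D Dc≈1
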